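{- Let $G=(V,E)$ be a directed graph and $K\subset V$ a set of $|K|=k$ terminals. Then there exists a reachability-preserving minor $H$ of $G$ whose number of non-terminal vertices $|V(H)\setminus K|$ is $O(k^{3})$.
   Context: A $k$-terminal digraph is a digraph $G=(V,E)$ with a designated terminal set $K\subset V$, $|K|=k$. A minor of a digraph $G$ is any digraph obtained from $G$ by a sequence of vertex deletions, edge deletions and edge contractions (contracting a directed edge $(u,v)$ identifies $u$ and $v$ into one vertex, discarding loops), where terminals are never deleted and no contraction identifies two terminals (a vertex obtained by merging a terminal with non-terminals is identified with that terminal). A digraph $H$ with $K\subseteq V(H)$ is a reachability-preserving minor (RPM) of $G$ if $H$ is a minor of $G$ and for all $x,x'\in K$ there is a directed path from $x$ to $x'$ in $H$ if and only if there is one in $G$. The size of $H$ is $|V(H)\setminus K|$. -}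

module Defs where

open import Level using (0ℓ)
open import Data.Nat.Base using (ℕ)
open import Data.Fin.Base using (Fin)
open import Data.Fin.Properties using (_≟_; any?)
open import Data.Fin.Subset using (Subset; _∈_; _∉_; _⊆_; _-_; _─_; ∣_∣)
open import Data.Fin.Subset.Properties using (x∈p∧x≢y⇒x∈p-y)
open import Data.Product.Base using (_×_; _,_; ∃-syntax; proj₁; proj₂)
open import Function.Bundles using (_⇔_)
open import Relation.Binary.Core using (Rel)
open import Relation.Binary.Definitions using (Decidable)
open import Relation.Binary.PropositionalEquality using (_≡_; _≢_; refl; sym)
open import Relation.Binary.Construct.Closure.ReflexiveTransitive using (Star)
open import Relation.Nullary using (¬_; yes; no)
open import Relation.Nullary.Decidable using (¬?; _×-dec_)

-- A finite digraph whose vertex set is an arbitrary subset of the pool of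
-- names Fin n.  Fixing the pool lets a minor keep the vertex names of the
-- original graph, so that K ⊆ V H holds literally.  There are no parallel
-- edges; loops are allowed.
record Digraph (n : ℕ) : Set₁ where
  field
    V    : Subset n
    E    : Rel (Fin n) 0ℓ
    E?   : Decidable E
    E⊆V² : ∀ {x y} → E x y → x ∈ V × y ∈ V

open Digraph public

-- There is a directed path from x to y (possibly of length zero).
Reachable : ∀ {n} → Digraph n → Rel (Fin n) 0ℓ
Reachable G = Star (E G)

deleteVertex : ∀ {n} → Digraph n → Fin n → Digraph n
deleteVertex G v = record
  { V    = V G - v
  ; E    = λ x y → E G x y × x ≢ v × y ≢ v
  ; E?   = λ x y → E? G x y ×-dec ¬? (x ≟ v) ×-dec ¬? (y ≟ v)
  ; E⊆V² = λ (e , x≢v , y≢v) →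
      x∈p∧x≢y⇒x∈p-y (proj₁ (E⊆V² G e)) x≢v ,
      x∈p∧x≢y⇒x∈p-y (proj₂ (E⊆V² G e)) y≢v
  }

deleteEdge : ∀ {n} → Digraph n → Fin n → Fin n → Digraph n
deleteEdge G u v = record
  { V    = V G
  ; E    = λ x y → E G x y × ¬ (x ≡ u × y ≡ v)
  ; E?   = λ x y → E? G x y ×-dec ¬? ((x ≟ u) ×-dec (y ≟ v))
  ; E⊆V² = λ (e , _) → E⊆V² G e
  }

rename : ∀ {n} (r s : Fin n) → Fin n → Fin n
rename r s x with x ≟ r
... | yes _ = s
... | no  _ = x

rename-∈ : ∀ {n} {p : Subset n} {r s x} →
           s ∈ p → r ≢ s → x ∈ p → rename r s x ∈ p - r
rename-∈ {r = r} {x = x} s∈p r≢s x∈p with x ≟ r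
... | yes _   = x∈p∧x≢y⇒x∈p-y s∈p (λ s≡r → r≢s (sym s≡r))
... | no  x≢r = x∈p∧x≢y⇒x∈p-y x∈p x≢r

-- Identify r with s; the merged vertex is called s.  The edges are the images
-- of the old edges, with loops discarded.
identify : ∀ {n} (G : Digraph n) (r s : Fin n) → s ∈ V G → r ≢ s → Digraph n
identify G r s s∈V r≢s = record
  { V    = V G - r
  ; E    = λ x y → x ≢ y ×
             ∃[ a ] ∃[ b ] E G a b × rename r s a ≡ x × rename r s b ≡ y
  ; E?   = λ x y → ¬? (x ≟ y) ×-dec
             any? λ a → any? λ b →
               E? G a b ×-dec (rename r s a ≟ x) ×-dec (rename r s b ≟ y)
  ; E⊆V² = λ { (_ , a , b , e , refl , refl) →
               rename-∈ s∈V r≢s (proj₁ (E⊆V² G e)) ,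
               rename-∈ s∈V r≢s (proj₂ (E⊆V² G e)) }
  }

-- One minor operation on a digraph with terminal set K.  Contracting an edge
-- (u , v) keeps the name of either endpoint, provided that the name given up
-- is not a terminal.  Hence two terminals are never identified, and a terminal
-- merged with a non-terminal remains that terminal.
data Step {n} (K : Subset n) (G : Digraph n) : Digraph n → Set₁ where
  delete-vertex    : ∀ {v} → v ∈ V G → v ∉ K → Step K G (deleteVertex G v)
  delete-edge      : ∀ {u v} → E G u v → Step K G (deleteEdge G u v)
  contract-to-tail : ∀ {u v} (e : E G u v) (v≢u : v ≢ u) → v ∉ K →
                     Step K G (identify G v u (proj₁ (E⊆V² G e)) v≢u)
  contract-to-head : ∀ {u v} (e : E G u v) (u≢v : u ≢ v) → u ∉ K →
                     Step K G (identify G u v (proj₂ (E⊆V² G e)) u≢v)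

_IsMinorOf_wrt_ : ∀ {n} → Digraph n → Digraph n → Subset n → Set₁
H IsMinorOf G wrt K = Star (Step K) G H

record IsRPM {n} (G : Digraph n) (K : Subset n) (H : Digraph n) : Set₁ where
  field
    terminals    : K ⊆ V H
    minor        : H IsMinorOf G wrt K
    reachability : ∀ {x x′} → x ∈ K → x′ ∈ K → Reachable H x x′ ⇔ Reachable G x x′

size : ∀ {n} → Subset n → Digraph n → ℕ
size K H = ∣ V H ─ K ∣

{-# OPTIONS --safe #-}

-- Delete every edge whose removal keeps the terminal reachability, and remove
-- every non-terminal v that has no in-neighbour or that can be contracted into a
-- neighbour harmlessly.  What survives is a digraph in which no non-terminal v
-- lies on a cycle, every such v has two distinct in-neighbours u and u′, and every
-- edge is critical: some terminal pair is disconnected without it.  If (u , v) is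
-- critical for (s , t) and (u′ , v) for (s′ , t′), then s reaches v only through u
-- and s′ only through u′.  The triple (s , t , s′) determines v: two vertices v and
-- w with the same triple both lie on every path from s to t, so one reaches the
-- other, say v reaches w; then s and s′ enter w by a common edge via v, although
-- their entries into w are different.  So there are at most k³ non-terminals.
module Submission where

open import Defs
open import Data.Fin.Base using (Fin; zero; suc; combine)
open import Data.Fin.Properties
  using (_≟_; any?; all?; ¬∀⟶∃¬; suc-injective; combine-injective; injective⇒≤)
open import Data.Fin.Subset using (Subset; inside; outside; _∈_; _∉_; _⊆_; _─_; ∣_∣)
open import Data.Fin.Subset.Properties
  using (_∈?_; p─q⊆p; x∈p∧x≢y⇒x∈p-y; x∈p⇒∣p-x∣<∣p∣)
open import Data.List.Base using (List; []; _∷_; allFin; cartesianProduct)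
open import Data.List.Membership.Propositional using () renaming (_∈_ to _∈ₗ_)
open import Data.List.Membership.Propositional.Properties using (∈-allFin; ∈-cartesianProduct⁺)
open import Data.List.Relation.Unary.Any using (here; there)
open import Data.Nat.Base using (ℕ; _*_; _^_; _≤_; _<_)
open import Data.Nat.Induction using (<-wellFounded)
open import Data.Nat.Properties using (*-identityˡ)
open import Data.Product.Base using (_×_; _,_; ∃-syntax; proj₁; proj₂)
import Data.Product.Base as Product
open import Data.Sum.Base using (_⊎_; inj₁; inj₂; [_,_]′)
import Data.Sum.Base as Sum
open import Data.Vec.Base using ([]; _∷_; here; there)
open import Function.Base using (_∘_; _∘′_; id)
open import Function.Bundles using (mk⇔; Equivalence)
open import Function.Construct.Identity using (⇔-id)
open import Induction.WellFounded using (Acc; acc)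
open import Level using (0ℓ)
open import Relation.Binary.Core using (Rel)
open import Relation.Binary.Construct.Closure.ReflexiveTransitive using (Star; ε; _◅_; _◅◅_; map)
open import Relation.Binary.Definitions using (Decidable)
open import Relation.Binary.PropositionalEquality using (_≡_; _≢_; refl; sym; trans; cong; cong₂; subst)
open import Relation.Nullary using (¬_; Dec; yes; no; contradiction)
open import Relation.Nullary.Decidable
  using (¬?; _×-dec_; _⊎-dec_; _→-dec_; map′; decidable-stable)

-- Counting in finite subsets

enum : ∀ {n} (p : Subset n) → Fin ∣ p ∣ → Fin n
enum (outside ∷ p) i       = suc (enum p i)
enum (inside  ∷ p) zero    = zero
enum (inside  ∷ p) (suc i) = suc (enum p i)

enum-∈ : ∀ {n} (p : Subset n) i → enum p i ∈ p
enum-∈ (outside ∷ p) i       = there (enum-∈ p i)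
enum-∈ (inside  ∷ p) zero    = here
enum-∈ (inside  ∷ p) (suc i) = there (enum-∈ p i)

enum-injective : ∀ {n} (p : Subset n) {i j} → enum p i ≡ enum p j → i ≡ j
enum-injective (outside ∷ p)                 eq = enum-injective p (suc-injective eq)
enum-injective (inside  ∷ p) {zero}  {zero}  eq = refl
enum-injective (inside  ∷ p) {suc i} {suc j} eq =
  cong suc (enum-injective p (suc-injective eq))

rank : ∀ {n} {p : Subset n} {x} → x ∈ p → Fin ∣ p ∣
rank                  here        = zero
rank {p = inside  ∷ p} (there x∈p) = suc (rank x∈p)
rank {p = outside ∷ p} (there x∈p) = rank x∈p

rank-injective : ∀ {n} {p : Subset n} {x y} (x∈p : x ∈ p) (y∈p : y ∈ p) →
                 rank x∈p ≡ rank y∈p → x ≡ y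
rank-injective                   here        here        eq = refl
rank-injective {p = inside  ∷ p} (there x∈p) (there y∈p) eq =
  cong suc (rank-injective x∈p y∈p (suc-injective eq))
rank-injective {p = outside ∷ p} (there x∈p) (there y∈p) eq =
  cong suc (rank-injective x∈p y∈p eq)

-- The ranks in `q` of a triple related to x encode x, injectively by `functional`. The triple is
-- drawn from `total` at `enum-∈ p i`, so it depends on the index alone.
∣p∣≤∣q∣^3 : ∀ {n} (p q : Subset n) (R : Fin n → Fin n → Fin n → Fin n → Set) →
  (∀ {x} → x ∈ p → ∃[ a ] ∃[ b ] ∃[ c ] a ∈ q × b ∈ q × c ∈ q × R x a b c) →
  (∀ {x y a b c} → R x a b c → R y a b c → x ≡ y) →
  ∣ p ∣ ≤ ∣ q ∣ ^ 3
∣p∣≤∣q∣^3 p q R total functional = injective⇒≤ code-injective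
  where
  code : Fin ∣ p ∣ → Fin (∣ q ∣ ^ 3)
  code i = let (_ , _ , _ , a∈q , b∈q , c∈q , _) = total (enum-∈ p i) in
    -- `∣ q ∣ ^ 3` unfolds to a product whose last factor is 1; `zero` fills that factor.
    combine (rank a∈q) (combine (rank b∈q) (combine (rank c∈q) zero))

  code-injective : ∀ {i j} → code i ≡ code j → i ≡ j
  code-injective {i} {j} eq
    with total (enum-∈ p i) | total (enum-∈ p j)
  ... | _ , _ , _ , a∈q , b∈q , c∈q , r | _ , _ , _ , a′∈q , b′∈q , c′∈q , r′
    with eqᵃ , eq ← combine-injective (rank a∈q) _ (rank a′∈q) _ eq
    with eqᵇ , eq ← combine-injective (rank b∈q) _ (rank b′∈q) _ eq
    with eqᶜ , _  ← combine-injective (rank c∈q) _ (rank c′∈q) _ eq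
    with refl ← rank-injective a∈q a′∈q eqᵃ
    with refl ← rank-injective b∈q b′∈q eqᵇ
    with refl ← rank-injective c∈q c′∈q eqᶜ
    = enum-injective p (functional r r′)

x∈p─q⇒x∉q : ∀ {n} (p q : Subset n) {x} → x ∈ p ─ q → x ∉ q
x∈p─q⇒x∉q (_ ∷ p) (outside ∷ q) here        ()
x∈p─q⇒x∉q (_ ∷ p) (outside ∷ q) (there x∈) (there x∈q) = x∈p─q⇒x∉q p q x∈ x∈q
x∈p─q⇒x∉q (_ ∷ p) (inside  ∷ q) (there x∈) (there x∈q) = x∈p─q⇒x∉q p q x∈ x∈q

-- Reachability

module _ {n} {E : Rel (Fin n) 0ℓ} where

  -- There is a path from x to y whose inner vertices lie in the list (Warshall).
  Through : List (Fin n) → Rel (Fin n) 0ℓ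
  Through []       x y = x ≡ y ⊎ E x y
  Through (w ∷ ws) x y = Through ws x y ⊎ (Through ws x w × Through ws w y)

  through? : Decidable E → ∀ ws → Decidable (Through ws)
  through? E? []       x y = (x ≟ y) ⊎-dec E? x y
  through? E? (w ∷ ws) x y =
    through? E? ws x y ⊎-dec (through? E? ws x w ×-dec through? E? ws w y)

  through-base : ∀ ws {x y} → x ≡ y ⊎ E x y → Through ws x y
  through-base []       = id
  through-base (w ∷ ws) = inj₁ ∘′ through-base ws

  -- If `w` heads the list, both halves are cut at `w`. Otherwise, when both halves visit the head,
  -- the segment between the two visits is dropped.
  through-trans : ∀ ws {x y w} → w ∈ₗ ws → Through ws x w → Through ws w y → Through ws x y
  through-trans (w ∷ ws) (here refl) p q = inj₂ ([ id , proj₁ ]′ p , [ id , proj₂ ]′ q)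
  through-trans (w ∷ ws) (there i) (inj₁ p)       (inj₁ q)       = inj₁ (through-trans ws i p q)
  through-trans (w ∷ ws) (there i) (inj₁ p)       (inj₂ (q , r)) = inj₂ (through-trans ws i p q , r)
  through-trans (w ∷ ws) (there i) (inj₂ (p , q)) (inj₁ r)       = inj₂ (p , through-trans ws i q r)
  through-trans (w ∷ ws) (there i) (inj₂ (p , _)) (inj₂ (_ , q)) = inj₂ (p , q)

  through⇒star : ∀ ws {x y} → Through ws x y → Star E x y
  through⇒star []       (inj₁ refl)    = ε
  through⇒star []       (inj₂ e)       = e ◅ ε
  through⇒star (w ∷ ws) (inj₁ p)       = through⇒star ws p
  through⇒star (w ∷ ws) (inj₂ (p , q)) = through⇒star ws p ◅◅ through⇒star ws q

  star⇒through : ∀ {x y} → Star E x y → Through (allFin n) x y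
  star⇒through ε       = through-base (allFin n) (inj₁ refl)
  star⇒through (e ◅ π) =
    through-trans (allFin n) (∈-allFin _) (through-base (allFin n) (inj₂ e)) (star⇒through π)

reachable? : ∀ {n} (G : Digraph n) → Decidable (Reachable G)
reachable? {n} G x y =
  map′ (through⇒star (allFin n)) star⇒through (through? (E? G) (allFin n) x y)

-- The recursion stops at the first use of `(u , v)`; what follows is returned as a path of `G` and
-- may use the edge again.
reachable-split : ∀ {n} (G : Digraph n) u v {x y} → Reachable G x y →
  Reachable (deleteEdge G u v) x y ⊎ (Reachable G x u × Reachable G v y)
reachable-split G u v ε = inj₁ ε
reachable-split G u v {x} (_◅_ {j = z} e π) with (x ≟ u) ×-dec (z ≟ v)
... | yes (refl , refl) = inj₂ (ε , π)
... | no ¬uv = Sum.map ((e , ¬uv) ◅_) (Product.map₁ (e ◅_)) (reachable-split G u v π)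

first-exit : ∀ {n} (G : Digraph n) {x y} → Reachable G x y → x ≢ y →
             ∃[ z ] x ≢ z × E G x z × Reachable G z y
first-exit G ε x≢y = contradiction refl x≢y
first-exit G {x} (_◅_ {j = z} e π) x≢y with x ≟ z
-- A loop at the start makes no progress and is skipped.
... | yes refl = first-exit G π x≢y
... | no x≢z   = z , x≢z , e , π

last-entry : ∀ {n} (G : Digraph n) {x y} → Reachable G x y → x ≢ y →
             ∃[ z ] z ≢ y × Reachable G x z × E G z y
last-entry G ε x≢y = contradiction refl x≢y
last-entry G {x} {y} (_◅_ {j = z} e π) x≢y with z ≟ y
... | yes refl = x , x≢y , ε , e
... | no z≢y   = let (w , w≢y , ρ , f) = last-entry G π z≢y in w , w≢y , e ◅ ρ , f

-- Reachability-preserving operations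

module _ {n} {K : Subset n} where

  isRPM-refl : ∀ {G} → K ⊆ V G → IsRPM G K G
  isRPM-refl K⊆V = record
    { terminals = K⊆V ; minor = ε ; reachability = λ _ _ → ⇔-id _ }

  isRPM-trans : ∀ {G H I} → IsRPM G K H → IsRPM H K I → IsRPM G K I
  isRPM-trans H≼G I≼H = record
    { terminals    = I≼H.terminals
    ; minor        = H≼G.minor ◅◅ I≼H.minor
    ; reachability = λ x∈K y∈K → mk⇔
        (Equivalence.to   (H≼G.reachability x∈K y∈K) ∘ Equivalence.to   (I≼H.reachability x∈K y∈K))
        (Equivalence.from (I≼H.reachability x∈K y∈K) ∘ Equivalence.from (H≼G.reachability x∈K y∈K))
    }
    where
    module H≼G = IsRPM H≼G
    module I≼H = IsRPM I≼H

rename-≢ : ∀ {n} {r s x : Fin n} → x ≢ r → rename r s x ≡ x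
rename-≢ {r = r} {x = x} x≢r with x ≟ r
... | yes x≡r = contradiction x≡r x≢r
... | no _    = refl

module _ {n} (G : Digraph n) {r s : Fin n} (s∈V : s ∈ V G) (r≢s : r ≢ s) where

  -- An edge whose ends receive the same name would become a loop, which `identify` discards; the
  -- path skips it.
  identify-reachable⁺ : ∀ {x y} → Reachable G x y →
    Reachable (identify G r s s∈V r≢s) (rename r s x) (rename r s y)
  identify-reachable⁺ ε = ε
  identify-reachable⁺ {x} {y} (_◅_ {j = z} e π) with rename r s x ≟ rename r s z
  ... | yes eq = subst (λ w → Reachable (identify G r s s∈V r≢s) w (rename r s y)) (sym eq)
                       (identify-reachable⁺ π)
  ... | no neq = (neq , x , z , e , refl , refl) ◅ identify-reachable⁺ π

  -- Each edge of the quotient lifts to a path: if it left `r`, a path from `s` to `r` is put before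
  -- it; if it entered `r`, a path to `s` replaces it.
  identify-reachable⁻ : Reachable G s r → (∀ a → a ≢ r → E G a r → Reachable G a s) →
    ∀ {x y} → Reachable (identify G r s s∈V r≢s) x y → Reachable G x y
  identify-reachable⁻ s⇝r in⇝s ε = ε
  identify-reachable⁻ s⇝r in⇝s ((x≢y , a , b , e , refl , refl) ◅ π) =
    lift-edge ◅◅ identify-reachable⁻ s⇝r in⇝s π
    where
    lift-edge : Reachable G (rename r s a) (rename r s b)
    lift-edge with a ≟ r | b ≟ r
    ... | yes _    | yes _    = ε
    ... | yes refl | no  _    = s⇝r ◅◅ e ◅ ε
    ... | no  a≢r  | yes refl = in⇝s a a≢r e
    ... | no  _    | no  _    = e ◅ ε

-- The last condition ensures that contracting v into s creates no new
-- reachability: a path entering v and leaving from s can be rerouted through s.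
Absorbable : ∀ {n} → Digraph n → Fin n → Fin n → Set
Absorbable G v s = v ≢ s × (E G s v ⊎ E G v s) × Reachable G s v ×
                   (∀ a → a ≢ v → E G a v → Reachable G a s)

absorbable? : ∀ {n} (G : Digraph n) → Decidable (Absorbable G)
absorbable? G v s = ¬? (v ≟ s) ×-dec (E? G s v ⊎-dec E? G v s) ×-dec reachable? G s v ×-dec
  all? λ a → ¬? (a ≟ v) →-dec E? G a v →-dec reachable? G a s

Unentered : ∀ {n} → Digraph n → Fin n → Set
Unentered G v = ∀ u → u ≢ v → ¬ E G u v

Reducible : ∀ {n} → Digraph n → Subset n → Fin n → Set
Reducible G K v = v ∈ V G × v ∉ K × (Unentered G v ⊎ ∃[ s ] Absorbable G v s)

reducible? : ∀ {n} (G : Digraph n) K v → Dec (Reducible G K v)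
reducible? G K v = (v ∈? V G) ×-dec ¬? (v ∈? K) ×-dec
  ((all? λ u → ¬? (u ≟ v) →-dec ¬? (E? G u v)) ⊎-dec any? (absorbable? G v))

deleteVertex-reachable : ∀ {n} (G : Digraph n) {v} → Unentered G v →
  ∀ {x y} → x ≢ v → Reachable G x y → Reachable (deleteVertex G v) x y
deleteVertex-reachable G unentered x≢v ε = ε
deleteVertex-reachable G {v} unentered {x} x≢v (_◅_ {j = z} e π) =
  (e , x≢v , z≢v) ◅ deleteVertex-reachable G unentered z≢v π
  where
  z≢v : z ≢ v
  z≢v refl = unentered x x≢v e

∈-∉⇒≢ : ∀ {n} {p : Subset n} {x y} → x ∈ p → y ∉ p → x ≢ y
∈-∉⇒≢ x∈p y∉p refl = y∉p x∈p

module _ {n} (G : Digraph n) {K : Subset n} (K⊆V : K ⊆ V G) where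

  -- `step` is a parameter because the edge between `v` and `s` may point either way.
  absorb-isRPM : ∀ {v s} (s∈V : s ∈ V G) → v ∉ K → ((v≢s , _) : Absorbable G v s) →
    Step K G (identify G v s s∈V v≢s) → IsRPM G K (identify G v s s∈V v≢s)
  absorb-isRPM {v} {s} s∈V v∉K (v≢s , _ , s⇝v , in⇝s) step = record
    { terminals    = λ x∈K → x∈p∧x≢y⇒x∈p-y (K⊆V x∈K) (∈-∉⇒≢ x∈K v∉K)
    ; minor        = step ◅ ε
    ; reachability = λ x∈K y∈K → mk⇔
        (identify-reachable⁻ G s∈V v≢s s⇝v in⇝s)
        (subst id (cong₂ (Reachable (identify G v s s∈V v≢s))
                     (rename-≢ (∈-∉⇒≢ x∈K v∉K)) (rename-≢ (∈-∉⇒≢ y∈K v∉K)))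
          ∘ identify-reachable⁺ G s∈V v≢s)
    }

  reduce : ∀ {v} → Reducible G K v → ∃[ H ] IsRPM G K H × ∣ V H ∣ < ∣ V G ∣
  reduce {v} (v∈V , v∉K , inj₁ unentered) = deleteVertex G v , isRPM , x∈p⇒∣p-x∣<∣p∣ v∈V
    where
    isRPM : IsRPM G K (deleteVertex G v)
    isRPM = record
      { terminals    = λ x∈K → x∈p∧x≢y⇒x∈p-y (K⊆V x∈K) (∈-∉⇒≢ x∈K v∉K)
      ; minor        = delete-vertex v∈V v∉K ◅ ε
      ; reachability = λ x∈K _ → mk⇔ (map proj₁)
          (deleteVertex-reachable G unentered (∈-∉⇒≢ x∈K v∉K))
      }
  reduce {v} (v∈V , v∉K , inj₂ (s , absorbable@(v≢s , inj₁ e , _))) =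
    _ , absorb-isRPM _ v∉K absorbable (contract-to-tail e v≢s v∉K) , x∈p⇒∣p-x∣<∣p∣ v∈V
  reduce {v} (v∈V , v∉K , inj₂ (s , absorbable@(v≢s , inj₂ e , _))) =
    _ , absorb-isRPM _ v∉K absorbable (contract-to-head e v≢s v∉K) , x∈p⇒∣p-x∣<∣p∣ v∈V

-- Critical edges and the deletion of all others

Critical : ∀ {n} → Digraph n → Subset n → Rel (Fin n) 0ℓ
Critical G K u v = ∃[ s ] ∃[ t ] s ∈ K × t ∈ K ×
  Reachable G s t × ¬ Reachable (deleteEdge G u v) s t

critical? : ∀ {n} (G : Digraph n) K → Decidable (Critical G K)
critical? G K u v = any? λ s → any? λ t → (s ∈? K) ×-dec (t ∈? K) ×-dec
  reachable? G s t ×-dec ¬? (reachable? (deleteEdge G u v) s t)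

deleteEdge-isRPM : ∀ {n} (G : Digraph n) {K : Subset n} {u v} → K ⊆ V G → E G u v →
                   ¬ Critical G K u v → IsRPM G K (deleteEdge G u v)
deleteEdge-isRPM G {u = u} {v} K⊆V e ¬critical = record
  { terminals    = K⊆V
  ; minor        = delete-edge e ◅ ε
  ; reachability = λ {x} {y} x∈K y∈K → mk⇔ (map proj₁) λ π →
      decidable-stable (reachable? (deleteEdge G u v) x y)
        λ ¬π → ¬critical (x , y , x∈K , y∈K , π , ¬π)
  }

-- Terminal reachability survives by `rpm`, and a path avoiding both edges avoids `(u , v)`. Hence
-- harmless deletions keep edges critical, and `prune` needs only one pass.
critical-deleteEdge : ∀ {n} (G : Digraph n) {K : Subset n} {a b u v} →
  IsRPM G K (deleteEdge G a b) → Critical G K u v → Critical (deleteEdge G a b) K u v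
critical-deleteEdge G rpm (s , t , s∈K , t∈K , π , ¬π) =
  s , t , s∈K , t∈K , Equivalence.from (IsRPM.reachability rpm s∈K t∈K) π ,
  ¬π ∘ map (Product.map₁ proj₁)

prune : ∀ {n} {K : Subset n} (L : List (Fin n × Fin n)) (G : Digraph n) → K ⊆ V G →
  ∃[ H ] IsRPM G K H × V H ≡ V G × (∀ {u v} → (u , v) ∈ₗ L → E H u v → Critical H K u v)
prune []            G K⊆V = G , isRPM-refl K⊆V , refl , λ ()
prune {K = K} ((u , v) ∷ L) G K⊆V with prune L G K⊆V
... | H , H≼G , same-V , critical with E? H u v | critical? H K u v
...   | no ¬e | _     = H , H≼G , same-V , λ where
          (here refl) e → contradiction e ¬e
          (there i)   e → critical i e
...   | yes _ | yes c = H , H≼G , same-V , λ where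
          (here refl) _ → c
          (there i)   e → critical i e
...   | yes e | no ¬c = deleteEdge H u v , isRPM-trans H≼G H′≼H , same-V , λ where
          (here refl) (_ , ¬uv) → contradiction (refl , refl) ¬uv
          (there i)   (f , _)   → critical-deleteEdge H H′≼H (critical i f)
  where
  H′≼H : IsRPM H K (deleteEdge H u v)
  H′≼H = deleteEdge-isRPM H (IsRPM.terminals H≼G) e ¬c

-- Existence of a reduced minor

record IsReduced {n} (G : Digraph n) (K : Subset n) : Set where
  field
    critical    : ∀ {u v} → E G u v → Critical G K u v
    irreducible : ∀ v → ¬ Reducible G K v

-- Induction on the number of vertices: pruning keeps it and each reduction lowers it. Pruning is
-- repeated after a reduction to establish criticality afresh in the new digraph.
reducedRPM : ∀ {n} {K : Subset n} (G : Digraph n) → K ⊆ V G →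
             ∃[ H ] IsRPM G K H × IsReduced H K
reducedRPM {n} {K} G K⊆V = go G K⊆V (<-wellFounded _)
  where
  go : ∀ G → K ⊆ V G → Acc _<_ ∣ V G ∣ → ∃[ H ] IsRPM G K H × IsReduced H K
  go G K⊆V (acc rec)
    with prune (cartesianProduct (allFin n) (allFin n)) G K⊆V
  ... | H , H≼G , same-V , critical with any? (reducible? H K)
  ...   | no irreducible = H , H≼G , record
            { critical    = critical (∈-cartesianProduct⁺ (∈-allFin _) (∈-allFin _))
            ; irreducible = λ v r → irreducible (v , r)
            }
  ...   | yes (_ , r) =
    let (I , I≼H , ∣I∣<∣H∣) = reduce H (IsRPM.terminals H≼G) r
        (J , J≼I , reduced) = go I (IsRPM.terminals I≼H)
                                 (rec (subst (∣ V I ∣ <_) (cong ∣_∣ same-V) ∣I∣<∣H∣))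
    in J , isRPM-trans H≼G (isRPM-trans I≼H J≼I) , reduced

-- Counting non-terminals of a reduced digraph

module _ {n} (G : Digraph n) {K : Subset n} (reduced : IsReduced G K) where
  open IsReduced reduced

  Nonterminal : Fin n → Set
  Nonterminal v = v ∈ V G × v ∉ K

  -- Let `(v , z)` be the first non-loop edge of a cycle through `v`. Then `v` is absorbable into
  -- `z`: the cycle leads from `z` back to `v`, and every in-neighbour of `v` reaches `z` via `v`.
  acyclic : ∀ {v w} → Nonterminal v → v ≢ w → Reachable G v w → ¬ Reachable G w v
  acyclic {v} (v∈V , v∉K) v≢w v⇝w w⇝v =
    let (z , v≢z , e , z⇝w) = first-exit G v⇝w v≢w
    in irreducible v (v∈V , v∉K ,
         inj₂ (z , v≢z , inj₂ e , z⇝w ◅◅ w⇝v , λ _ _ f → f ◅ e ◅ ε))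

  -- With no in-neighbour other than itself, `v` is `Unentered`; with exactly one, `u`, it is
  -- absorbable into `u`.
  two-in-neighbours : ∀ {v} → Nonterminal v →
    ∃[ u ] ∃[ u′ ] u ≢ u′ × u ≢ v × u′ ≢ v × E G u v × E G u′ v
  two-in-neighbours {v} (v∈V , v∉K)
    with any? (λ u → ¬? (u ≟ v) ×-dec E? G u v)
  ... | no none = contradiction
          (v∈V , v∉K , inj₁ λ u u≢v e → none (u , u≢v , e)) (irreducible v)
  ... | yes (u , u≢v , e)
    with any? (λ u′ → ¬? (u ≟ u′) ×-dec ¬? (u′ ≟ v) ×-dec E? G u′ v)
  ...   | yes (u′ , u≢u′ , u′≢v , e′) = u , u′ , u≢u′ , u≢v , u′≢v , e , e′
  ...   | no unique = contradiction
          (v∈V , v∉K , inj₂ (u , u≢v ∘ sym , inj₁ e , e ◅ ε , only-u)) (irreducible v)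
    where
    only-u : ∀ a → a ≢ v → E G a v → Reachable G a u
    only-u a a≢v f with u ≟ a
    ... | yes refl = ε
    ... | no u≢a   = contradiction (a , u≢a , a≢v , f) unique

  EntersOnlyVia : Fin n → Fin n → Fin n → Set
  EntersOnlyVia s v u = ∀ {a} → Reachable G s a → a ≢ v → E G a v → a ≡ u

  -- Since v lies on no cycle, every continuation of a path from v to t avoids
  -- the edge (u , v).
  critical⇒entersOnlyVia : ∀ {u v s t} → Nonterminal v → u ≢ v → E G u v → Reachable G v t →
    ¬ Reachable (deleteEdge G u v) s t → EntersOnlyVia s v u
  critical⇒entersOnlyVia {u} {v} nt u≢v e v⇝t ¬s⇝t {a} s⇝a a≢v f with a ≟ u
  ... | yes a≡u = a≡u
  ... | no  a≢u with reachable-split G u v s⇝a | reachable-split G u v v⇝t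
  ...   | inj₂ (_ , v⇝a) | _ = contradiction (f ◅ ε) (acyclic nt (a≢v ∘ sym) v⇝a)
  ...   | inj₁ _ | inj₂ (v⇝u , _) = contradiction (e ◅ ε) (acyclic nt (u≢v ∘ sym) v⇝u)
  ...   | inj₁ s⇝a′ | inj₁ v⇝t′ =
    contradiction (s⇝a′ ◅◅ (f , a≢u ∘ proj₁) ◅ v⇝t′) ¬s⇝t

  -- As built by `label`, `(s , t)` is a pair for which `(u , v)` is critical, and `s′` is the
  -- source of such a pair for a second edge `(u′ , v)`. Keeping `u` and `u′` as fields leaves only
  -- terminals to count.
  record Label (v s t s′ : Fin n) : Set where
    field
      {u u′} : Fin n
      u≢u′   : u ≢ u′
      edge   : E G u v
      s⇝v    : Reachable G s v
      v⇝t    : Reachable G v t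
      s′⇝v   : Reachable G s′ v
      cut    : ¬ Reachable (deleteEdge G u v) s t
      via    : EntersOnlyVia s v u
      via′   : EntersOnlyVia s′ v u′

  label : ∀ {v} → Nonterminal v →
    ∃[ s ] ∃[ t ] ∃[ s′ ] s ∈ K × t ∈ K × s′ ∈ K × Label v s t s′
  label {v} nt
    with u , u′ , u≢u′ , u≢v , u′≢v , e , e′ ← two-in-neighbours nt
    with critical e | critical e′
  ... | s , t , s∈K , t∈K , π , ¬π | s′ , t′ , s′∈K , _ , π′ , ¬π′
    with reachable-split G u v π | reachable-split G u′ v π′
  -- Deleting a critical edge separates its pair, so only the case where both paths use their edges
  -- remains.
  ...   | inj₁ ρ | _ = contradiction ρ ¬π
  ...   | inj₂ _ | inj₁ ρ = contradiction ρ ¬π′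
  ...   | inj₂ (s⇝u , v⇝t) | inj₂ (s′⇝u′ , v⇝t′) = s , t , s′ , s∈K , t∈K , s′∈K , record
    { u≢u′ = u≢u′
    ; edge = e
    ; s⇝v  = s⇝u ◅◅ e ◅ ε
    ; v⇝t  = v⇝t
    ; s′⇝v = s′⇝u′ ◅◅ e′ ◅ ε
    ; cut  = ¬π
    ; via  = critical⇒entersOnlyVia nt u≢v e v⇝t ¬π
    ; via′ = critical⇒entersOnlyVia nt u′≢v e′ v⇝t′ ¬π′
    }

  -- A path from v to w would enter w by one edge, although s and s′, which
  -- both reach v, enter w by different edges.
  label-unordered : ∀ {v w s t s′} → Label v s t s′ → Label w s t s′ →
                    v ≢ w → ¬ Reachable G v w
  label-unordered lᵛ lʷ v≢w v⇝w =
    let (a , a≢w , v⇝a , f) = last-entry G v⇝w v≢w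
    in W.u≢u′ (trans (sym (W.via (V.s⇝v ◅◅ v⇝a) a≢w f)) (W.via′ (V.s′⇝v ◅◅ v⇝a) a≢w f))
    where
    module V = Label lᵛ
    module W = Label lʷ

  -- All paths from s to t pass through both v and w, so one of v and w reaches the other.
  label-functional : ∀ {v w s t s′} → Label v s t s′ → Label w s t s′ → v ≡ w
  label-functional {v} {w} lᵛ lʷ = decidable-stable (v ≟ w) λ v≢w →
    [ label-unordered lᵛ lʷ v≢w , label-unordered lʷ lᵛ (v≢w ∘ sym) ]′ comparable
    where
    module V = Label lᵛ
    module W = Label lʷ
    comparable : Reachable G v w ⊎ Reachable G w v
    comparable with reachable-split G W.u w V.s⇝v | reachable-split G W.u w V.v⇝t
    ... | inj₂ (_ , w⇝v) | _ = inj₂ w⇝v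
    ... | inj₁ _ | inj₂ (v⇝u , _) = inj₁ (v⇝u ◅◅ W.edge ◅ ε)
    ... | inj₁ s⇝v | inj₁ v⇝t = contradiction (s⇝v ◅◅ v⇝t) W.cut

  reduced-size : size K G ≤ ∣ K ∣ ^ 3
  reduced-size = ∣p∣≤∣q∣^3 (V G ─ K) K Label
    (λ v∈ → label (p─q⊆p (V G) K v∈ , x∈p─q⇒x∉q (V G) K v∈)) label-functional

theorem1p1 : ∃[ C ] ((n k : ℕ) (G : Digraph n) (K : Subset n) → K ⊆ V G → ∣ K ∣ ≡ k →
    ∃[ H ] (IsRPM G K H × size K H ≤ C * k ^ 3))
theorem1p1 = 1 , λ where
  n k G K K⊆V refl →
    let (H , H≼G , reduced) = reducedRPM G K⊆V
    in H , H≼G , subst (size K H ≤_) (sym (*-identityˡ _)) (reduced-size H reduced)
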